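{- Let $\varphi$ be a skew morphism of a finite abelian group $B$, let $K=\ker\varphi$, and let $q$ be any prime divisor of $|K|$. Let $N$ be the subgroup of $K$ consisting of the identity and all elements of order $q$, and let $L$ be the subgroup of $B$ containing $N$ such that $L/N$ is the kernel of the skew morphism $\varphi_N^*$ of $B/N$ induced by $\varphi$. If $p$ is a prime that divides $|L|$ but not $|K|$, then $p<q$.
   Context: For a finite group $B$, a skew morphism of $B$ is a permutation $\varphi$ of $B$ fixing the identity such that for every $a\in B$ there is a positive integer $i_a$ with $\varphi(ab)=\varphi(a)\varphi^{i_a}(b)$ for all $b\in B$. Its order $\mathrm{ord}(\varphi)$ is the order of $\langle\varphi\rangle$. The power function $\pi$ maps $a$ to the unique such $i_a\in\{1,\dots,\mathrm{ord}(\varphi)\}$ (with $\pi\equiv 1$ for the identity), and the kernel is $\ker\varphi=\{a\in B:\pi(a)=1\}$, a subgroup of $B$. For $B$ abelian, $\varphi$ restricts to an automorphism of $\ker\varphi$, so it preserves $N$; the induced skew morphism $\varphi_N^*$ of $B/N$ is the well-defined skew morphism $Nx\mapsto N\varphi(x)$, and its kernel is a subgroup of $B/N$, hence of the form $L/N$ with $N\le L\le B$. -}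

module Defs where

open import Data.Nat using (ℕ; zero; suc; _<_)
open import Data.Fin using (Fin)
open import Data.List using (List; length)
open import Data.List.Membership.Propositional using (_∈_)
open import Data.List.Relation.Unary.Unique.Propositional using (Unique)
open import Data.Product using (Σ; _×_)
open import Data.Sum using (_⊎_)
open import Relation.Binary.PropositionalEquality using (_≡_; _≢_)
open import Relation.Nullary using (¬_)
open import Function.Bundles using (_⇔_)
open import Function.Definitions using (Bijective)
open import Algebra.Structures using (IsAbelianGroup)

-- A finite abelian group B of order n, presented on the carrier Fin n
-- (every finite abelian group is isomorphic to one of this form).
record FinAbGroup : Set where
  field
    n       : ℕ
    _·_     : Fin n → Fin n → Fin n
    e       : Fin n
    inv     : Fin n → Fin n
    isAbGrp : IsAbelianGroup _≡_ _·_ e inv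
  infixl 7 _·_

module _ (B : FinAbGroup) where
  open FinAbGroup B

  iter : (Fin n → Fin n) → ℕ → Fin n → Fin n
  iter f zero    x = x
  iter f (suc k) x = f (iter f k x)

  pow : Fin n → ℕ → Fin n
  pow a zero    = e
  pow a (suc k) = a · pow a k

  HasOrder : Fin n → ℕ → Set
  HasOrder a k = (0 < k) × (pow a k ≡ e) × (∀ j → 0 < j → j < k → pow a j ≢ e)

  AdmissiblePower : (Fin n → Fin n) → Fin n → ℕ → Set
  AdmissiblePower φ a i = ∀ b → φ (a · b) ≡ φ a · iter φ i b

  record IsSkewMorphism (φ : Fin n → Fin n) : Set where
    field
      bijective : Bijective _≡_ _≡_ φ
      fixes-e   : φ e ≡ e
      powers    : ∀ a → Σ ℕ λ i → (0 < i) × AdmissiblePower φ a i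

  -- kernel of φ: elements whose power value π(a) is 1, i.e. for which
  -- the exponent 1 is admissible (π(a) is the unique admissible exponent
  -- in {1,…,ord φ}, so π(a) = 1 iff 1 is admissible).
  Ker : (Fin n → Fin n) → Fin n → Set
  Ker φ a = AdmissiblePower φ a 1

  NSub : (Fin n → Fin n) → ℕ → Fin n → Set
  NSub φ q a = Ker φ a × (a ≡ e ⊎ HasOrder a q)

  -- L : preimage in B of the kernel of the induced skew morphism
  -- φ*_N (Nx ↦ Nφ(x)) of B/N.  Nx lies in ker φ*_N iff for all Ny,
  -- φ*(Nx·Ny) = φ*(Nx) φ*(Ny), i.e. N φ(xy) = N φ(x)φ(y), i.e.
  -- φ(xy) (φ(x)φ(y))⁻¹ ∈ N for all y.
  LSub : (Fin n → Fin n) → ℕ → Fin n → Set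
  LSub φ q x = ∀ y → NSub φ q (φ (x · y) · inv (φ x · φ y))

  HasCard : (Fin n → Set) → ℕ → Set
  HasCard P k = Σ (List (Fin n)) λ xs →
    Unique xs × (length xs ≡ k) × (∀ a → P a ⇔ a ∈ xs)

{-# OPTIONS --safe #-}

-- For x ∈ L put ψₓ = φ^(π(x)-1), so that φ(xy) = φ(x) ψₓ(φ(y)).  By commutativity
-- ψₓ fixes ker φ pointwise, and x ∈ L means that ψₓ preserves every coset of N.
-- Hence ψₓ translates each coset of N by an element of N, and ψₓ^q = 1.  The cyclic
-- group ⟨φ⟩ has at most q elements ψ with ψ^q = 1, while ψₓ determines the coset
-- of x modulo K = ker φ.  So |L| = c|K| with c ≤ q; a prime p dividing |L| but
-- not |K| divides c, whence p ≤ q, and p ≠ q because q divides |K|.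
module Submission where

open import Defs
open import Algebra.Bundles using (AbelianGroup)
open import Data.Fin as Fin using (Fin; toℕ)
import Data.Fin.Properties as Fin
open import Data.List using (List; []; _∷_; length; filter; map)
open import Data.List.Membership.Propositional using (_∈_)
open import Data.List.Membership.Propositional.Properties
  using (∈-filter⁺; ∈-filter⁻; ∈-map⁺; ∈-map⁻; ∈-length)
open import Data.List.Properties using (filter-all; filter-none; filter-notAll; length-map)
open import Data.List.Relation.Binary.Subset.Propositional using (_⊆_)
open import Data.List.Relation.Unary.All as All using (All; []; _∷_)
open import Data.List.Relation.Unary.AllPairs using ([]; _∷_)
open import Data.List.Relation.Unary.Any as Any using (here; there)
open import Data.List.Relation.Unary.Unique.Propositional using (Unique)
import Data.List.Relation.Unary.Unique.Propositional.Properties as Unique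
open import Data.Nat
  using (ℕ; zero; suc; _+_; _*_; _∸_; _^_; _≤_; _<_; _≟_; _<?_; s≤s; z≤n; NonZero; >-nonZero)
open import Data.Nat.Divisibility using (_∣_; ∣⇒≤; m%n≡0⇒n∣m)
open import Data.Nat.DivMod
  using (_/_; _%_; m%n<n; m≡m%n+[m/n]*n; m/n*n≡m; m<n*o⇒m/o<n; m*n%n≡0)
open import Data.Nat.Induction using (<-rec)
open import Data.Nat.Primality using (Prime; euclidsLemma; prime⇒nonZero)
open import Data.Nat.Properties hiding (_≟_; _<?_)
open import Data.Product using (∃; _×_; _,_; proj₁; proj₂)
open import Data.Sum as Sum using (_⊎_; inj₁; inj₂; [_,_])
open import Function using (_∘_)
open import Function.Bundles using (Equivalence)
open import Relation.Binary.PropositionalEquality hiding ([_])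
open import Relation.Nullary using (¬_; yes; no; contradiction; ¬?; _×-dec_)
open import Relation.Unary using (Decidable)

open ≡-Reasoning

-- Least witnesses and counting in lists.

least : {P : ℕ → Set} → Decidable P → ∀ n → P n → ∃ λ m → P m × (∀ k → k < m → ¬ P k)
least {P} P? = <-rec _ search
  where
  search : ∀ n → (∀ {m} → m < n → P m → ∃ λ m → P m × (∀ k → k < m → ¬ P k)) →
           P n → ∃ λ m → P m × (∀ k → k < m → ¬ P k)
  search n rec Pn with anyUpTo? P? n
  ... | yes (m , m<n , Pm) = rec m<n Pm
  ... | no none = n , Pn , λ k k<n Pk → none (k , k<n , Pk)

-- Filtering the head `x` out of `ys` shortens it strictly, yet keeps the tail of `xs`, which avoids
-- `x` by uniqueness.
unique-⊆⇒length≤ : ∀ {n} {xs ys : List (Fin n)} → Unique xs → xs ⊆ ys → length xs ≤ length ys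
unique-⊆⇒length≤ [] _ = z≤n
unique-⊆⇒length≤ {xs = x ∷ xs} {ys} (x∉xs ∷ uniq) sub = ≤-<-trans
  (unique-⊆⇒length≤ uniq λ v∈xs →
    ∈-filter⁺ ≢x? (sub (there v∈xs)) (All.lookup x∉xs v∈xs ∘ sym))
  (filter-notAll ≢x? ys (Any.map (λ x≡y y≢x → y≢x (sym x≡y)) (sub (here refl))))
  where
  ≢x? : Decidable (_≢ x)
  ≢x? y = ¬? (y Fin.≟ x)

module _ {A : Set} {P Q R : A → Set} (P? : Decidable P) (Q? : Decidable Q) (R? : Decidable R)
  (P⇒Q⊎R : ∀ x → P x → Q x ⊎ R x) (Q⇒P : ∀ x → Q x → P x) (R⇒P : ∀ x → R x → P x)
  (Q⇒¬R : ∀ x → Q x → ¬ R x) where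

  length-filter-⊎ : ∀ xs → length (filter P? xs) ≡ length (filter Q? xs) + length (filter R? xs)
  length-filter-⊎ [] = refl
  length-filter-⊎ (x ∷ xs) with P? x | Q? x | R? x
  ... | yes _ | yes q | yes r = contradiction r (Q⇒¬R x q)
  ... | yes _ | yes _ | no  _ = cong suc (length-filter-⊎ xs)
  ... | yes _ | no  _ | yes _ = trans (cong suc (length-filter-⊎ xs)) (sym (+-suc _ _))
  ... | yes p | no ¬q | no ¬r = contradiction (P⇒Q⊎R x p) [ ¬q , ¬r ]
  ... | no ¬p | yes q | _     = contradiction (Q⇒P x q) ¬p
  ... | no ¬p | no  _ | yes r = contradiction (R⇒P x r) ¬p
  ... | no  _ | no  _ | no  _ = length-filter-⊎ xs

module _ {A : Set} (f : A → ℕ) where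

  length-filter-<suc : ∀ j xs →
    length (filter (λ x → f x <? suc j) xs) ≡
    length (filter (λ x → f x ≟ j) xs) + length (filter (λ x → f x <? j) xs)
  length-filter-<suc j = length-filter-⊎ _ _ _
    (λ _ → Sum.swap ∘ m<1+n⇒m<n∨m≡n) (λ _ → ≤-reflexive ∘ cong suc) (λ _ → m<n⇒m<1+n)
    (λ _ fx≡j fx<j → <⇒≢ fx<j fx≡j)

  module _ {k : ℕ} (xs : List A)
    (fibre : ∀ j → length (filter (λ x → f x ≟ j) xs) ≡ 0 ⊎ length (filter (λ x → f x ≟ j) xs) ≡ k)
    where

    -- The values `j < q` are added one fibre at a time, and `c` counts those for which `fibre`
    -- takes its second alternative. In the application the nonempty fibres on L are cosets of the
    -- kernel.
    length-filter-<-multiple : ∀ q → ∃ λ c → c ≤ q × length (filter (λ x → f x <? q) xs) ≡ c * k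
    length-filter-<-multiple zero =
      0 , z≤n , cong length (filter-none (λ x → f x <? 0) (All.universal (λ _ ()) xs))
    length-filter-<-multiple (suc q) with length-filter-<-multiple q | fibre q
    ... | c , c≤q , eq | inj₁ none = c , m≤n⇒m≤1+n c≤q ,
      trans (length-filter-<suc q xs) (cong₂ _+_ none eq)
    ... | c , c≤q , eq | inj₂ all  = suc c , s≤s c≤q ,
      trans (length-filter-<suc q xs) (cong₂ _+_ all eq)

    length-multiple : ∀ {q} → (∀ {x} → x ∈ xs → f x < q) → ∃ λ c → c ≤ q × length xs ≡ c * k
    length-multiple {q} f< with length-filter-<-multiple q
    ... | c , c≤q , eq = c , c≤q ,
      trans (sym (cong length (filter-all (λ x → f x <? q) (All.tabulate f<)))) eq

-- Iterates of a map.

module _ (B : FinAbGroup) (f : Fin (FinAbGroup.n B) → Fin (FinAbGroup.n B)) where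

  iter-+ : ∀ a b x → iter B f (a + b) x ≡ iter B f a (iter B f b x)
  iter-+ zero b x = refl
  iter-+ (suc a) b x = cong f (iter-+ a b x)

  iter-iter : ∀ j k x → iter B (iter B f j) k x ≡ iter B f (k * j) x
  iter-iter j zero x = refl
  iter-iter j (suc k) x = trans (cong (iter B f j) (iter-iter j k x)) (sym (iter-+ j (k * j) x))

  iter-suc : ∀ k x → iter B f k (f x) ≡ f (iter B f k x)
  iter-suc zero x = refl
  iter-suc (suc k) x = cong f (iter-suc k x)

  iter-fixed : ∀ k {x} → f x ≡ x → iter B f k x ≡ x
  iter-fixed zero fx = refl
  iter-fixed (suc k) fx = trans (cong f (iter-fixed k fx)) fx

module SkewMorphism (B : FinAbGroup) (φ : Fin (FinAbGroup.n B) → Fin (FinAbGroup.n B))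
  (skew : IsSkewMorphism B φ) where

  open FinAbGroup B
  open IsSkewMorphism skew

  group : AbelianGroup _ _
  group = record { isAbelianGroup = isAbGrp }

  open AbelianGroup group using (assoc; comm; identityˡ; identityʳ; inverseˡ; inverseʳ)
  open import Algebra.Properties.AbelianGroup group using (∙-cancelˡ; ∙-cancelʳ)

  -- Powers of `φ` and its order.

  φ^ : ℕ → Fin n → Fin n
  φ^ = iter B φ

  φ-injective : ∀ {x y} → φ x ≡ φ y → x ≡ y
  φ-injective = proj₁ bijective

  φ^-injective : ∀ k {x y} → φ^ k x ≡ φ^ k y → x ≡ y
  φ^-injective zero eq = eq
  φ^-injective (suc k) eq = φ^-injective k (φ-injective eq)

  φ^-cancel : ∀ {a b} → a ≤ b → φ^ a ≗ φ^ b → ∀ x → φ^ (b ∸ a) x ≡ x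
  φ^-cancel {a} {b} a≤b eq x = φ^-injective a (begin
    φ^ a (φ^ (b ∸ a) x) ≡⟨ iter-+ B φ a (b ∸ a) x ⟨
    φ^ (a + (b ∸ a)) x  ≡⟨ cong (λ k → φ^ k x) (m+[n∸m]≡n a≤b) ⟩
    φ^ b x              ≡⟨ eq x ⟨
    φ^ a x              ∎)

  IsPeriod : ℕ → Set
  IsPeriod k = 0 < k × (∀ x → φ^ k x ≡ x)

  isPeriod? : Decidable IsPeriod
  isPeriod? k = (0 <? k) ×-dec Fin.all? (λ x → φ^ k x Fin.≟ x)

  period-exists : ∃ IsPeriod
  period-exists
    -- `Fin (n ^ n)` encodes all self-maps of `Fin n`, so two of the iterates with exponents `0` to
    -- `n ^ n` coincide; the difference of their exponents is a period.
    with i , j , i<j , eq ← Fin.pigeonhole ≤-refl (λ (k : Fin (suc (n ^ n))) → Fin.funToFin (φ^ (toℕ k)))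
    = toℕ j ∸ toℕ i , m<n⇒0<n∸m i<j , φ^-cancel (<⇒≤ i<j) λ x → begin
      φ^ (toℕ i) x                                     ≡⟨ Fin.finToFun-funToFin (φ^ (toℕ i)) x ⟨
      Fin.finToFun (Fin.funToFin (φ^ (toℕ i))) x       ≡⟨ cong (λ h → Fin.finToFun h x) eq ⟩
      Fin.finToFun (Fin.funToFin (φ^ (toℕ j))) x       ≡⟨ Fin.finToFun-funToFin (φ^ (toℕ j)) x ⟩
      φ^ (toℕ j) x                                     ∎

  opaque
    leastPeriod : ∃ λ m → IsPeriod m × (∀ k → k < m → ¬ IsPeriod k)
    leastPeriod = least isPeriod? (proj₁ period-exists) (proj₂ period-exists)

  ord : ℕ
  ord = proj₁ leastPeriod

  φ^ord : ∀ x → φ^ ord x ≡ x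
  φ^ord = proj₂ (proj₁ (proj₂ leastPeriod))

  instance
    ord-nonZero : NonZero ord
    ord-nonZero = >-nonZero (proj₁ (proj₁ (proj₂ leastPeriod)))

  φ^-% : ∀ k → φ^ k ≗ φ^ (k % ord)
  φ^-% k x = begin
    φ^ k x                                ≡⟨ cong (λ h → φ^ h x) (m≡m%n+[m/n]*n k ord) ⟩
    φ^ (k % ord + k / ord * ord) x        ≡⟨ iter-+ B φ (k % ord) (k / ord * ord) x ⟩
    φ^ (k % ord) (φ^ (k / ord * ord) x)   ≡⟨ cong (φ^ (k % ord)) (iter-iter B φ ord (k / ord) x) ⟨
    φ^ (k % ord) (iter B (φ^ ord) (k / ord) x) ≡⟨ cong (φ^ (k % ord)) (iter-fixed B (φ^ ord) (k / ord) (φ^ord x)) ⟩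
    φ^ (k % ord) x                        ∎

  -- If `a < b`, cancelling leaves `b ∸ a` as a period below `ord`, against minimality. Applied in
  -- both directions to reduced exponents, this makes the residue modulo `ord` an invariant of the
  -- power of `φ`.
  φ^-≗⇒≤ : ∀ {a b} → b < ord → φ^ a ≗ φ^ b → b ≤ a
  φ^-≗⇒≤ {a} {b} b<ord eq = ≮⇒≥ λ a<b →
    proj₂ (proj₂ leastPeriod) (b ∸ a) (≤-<-trans (m∸n≤m b a) b<ord)
      (m<n⇒0<n∸m a<b , φ^-cancel (<⇒≤ a<b) eq)

  φ^-≗⇒%≡ : ∀ {a b} → φ^ a ≗ φ^ b → a % ord ≡ b % ord
  φ^-≗⇒%≡ {a} {b} eq = ≤-antisym
    (φ^-≗⇒≤ (m%n<n a ord) (sym ∘ eq%)) (φ^-≗⇒≤ (m%n<n b ord) eq%)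
    where
    eq% : φ^ (a % ord) ≗ φ^ (b % ord)
    eq% x = trans (sym (φ^-% a x)) (trans (eq x) (φ^-% b x))

  %≡⇒φ^-≗ : ∀ {a b} → a % ord ≡ b % ord → φ^ a ≗ φ^ b
  %≡⇒φ^-≗ {a} {b} eq x = trans (φ^-% a x) (trans (cong (λ k → φ^ k x) eq) (sym (φ^-% b x)))

  φ^≗id⇒%≡0 : ∀ {a} → (∀ x → φ^ a x ≡ x) → a % ord ≡ 0
  φ^≗id⇒%≡0 {a} eq = trans (φ^-≗⇒%≡ {a} {0} eq) (m*n%n≡0 0 ord)

  -- The power function and the kernel.

  admissible-suc : ∀ x → ∃ λ j → AdmissiblePower B φ x (suc j)
  admissible-suc x with powers x
  ... | suc j , _ , admissible = j , admissible

  -- Agrees with π(x) - 1 only modulo the order of φ: the chosen exponent is not reduced.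
  π-1 : Fin n → ℕ
  π-1 x = proj₁ (admissible-suc x)

  φ-· : ∀ x y → φ (x · y) ≡ φ x · φ (φ^ (π-1 x) y)
  φ-· x = proj₂ (admissible-suc x)

  -- Commutativity lets `φ (x · a)` be expanded both from `x` and from `a`, the latter with exponent
  -- 1; the two expansions are compared after cancelling `φ x`.
  φ^π-1-fixes-Ker : ∀ x {a} → Ker B φ a → φ^ (π-1 x) a ≡ a
  φ^π-1-fixes-Ker x {a} a∈K = φ-injective (∙-cancelˡ (φ x) _ _ (begin
    φ x · φ (φ^ (π-1 x) a) ≡⟨ φ-· x a ⟨
    φ (x · a)              ≡⟨ cong φ (comm x a) ⟩
    φ (a · x)              ≡⟨ a∈K x ⟩
    φ a · φ x              ≡⟨ comm (φ a) (φ x) ⟩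
    φ x · φ a              ∎))

  -- The power `φ^ (π-1 b)` commutes with `φ` and fixes `a`, hence fixes `φ a` as well; expanding
  -- `φ (b · φ a)` from `b` therefore produces exponent 1 on `φ a`.
  φ-Ker : ∀ {a} → Ker B φ a → Ker B φ (φ a)
  φ-Ker {a} a∈K b = begin
    φ (φ a · b)                ≡⟨ cong φ (comm (φ a) b) ⟩
    φ (b · φ a)                ≡⟨ φ-· b (φ a) ⟩
    φ b · φ (φ^ (π-1 b) (φ a)) ≡⟨ cong (λ z → φ b · φ z) (iter-suc B φ (π-1 b) a) ⟩
    φ b · φ (φ (φ^ (π-1 b) a)) ≡⟨ cong (λ z → φ b · φ (φ z)) (φ^π-1-fixes-Ker b a∈K) ⟩
    φ b · φ (φ a)              ≡⟨ comm (φ b) (φ (φ a)) ⟩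
    φ (φ a) · φ b              ∎

  φ^-Ker : ∀ k {a} → Ker B φ a → Ker B φ (φ^ k a)
  φ^-Ker zero a∈K = a∈K
  φ^-Ker (suc k) a∈K = φ-Ker (φ^-Ker k a∈K)

  φ^-Ker-· : ∀ k {a} → Ker B φ a → ∀ b → φ^ k (a · b) ≡ φ^ k a · φ^ k b
  φ^-Ker-· zero a∈K b = refl
  φ^-Ker-· (suc k) a∈K b = trans (cong φ (φ^-Ker-· k a∈K b)) (φ^-Ker k a∈K _)

  -- Powers of `φ` that translate within cosets of N.

  pow-suc-· : ∀ a k z → pow B a k · (a · z) ≡ pow B a (suc k) · z
  pow-suc-· a k z = trans (sym (assoc _ a z)) (cong (_· z) (comm _ a))

  -- `f` commutes with multiplication by `a`, so it passes through `pow B a k` and contributes one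
  -- more factor at `z`. Being a translation is assumed at the single point `z`, since in the
  -- application `a` may vary with `z`.
  iter-translation : ∀ {f a z} → (∀ w → f (a · w) ≡ a · f w) → f z ≡ a · z →
                     ∀ k → iter B f k z ≡ pow B a k · z
  iter-translation f-a fz zero = sym (identityˡ _)
  iter-translation {f} {a} {z} f-a fz (suc k) = begin
    f (iter B f k z)    ≡⟨ cong f (iter-translation f-a fz k) ⟩
    f (pow B a k · z)   ≡⟨ f-pow k ⟩
    pow B a k · f z     ≡⟨ cong (pow B a k ·_) fz ⟩
    pow B a k · (a · z) ≡⟨ pow-suc-· a k z ⟩
    pow B a (suc k) · z ∎
    where
    f-pow : ∀ k → f (pow B a k · z) ≡ pow B a k · f z
    f-pow zero = trans (cong f (identityˡ z)) (sym (identityˡ _))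
    f-pow (suc k) = begin
      f (a · pow B a k · z)   ≡⟨ cong f (assoc a _ z) ⟩
      f (a · (pow B a k · z)) ≡⟨ f-a _ ⟩
      a · f (pow B a k · z)   ≡⟨ cong (a ·_) (f-pow k) ⟩
      a · (pow B a k · f z)   ≡⟨ assoc a _ _ ⟨
      a · pow B a k · f z     ∎

  NSub-pow : ∀ {q a} → NSub B φ q a → pow B a q ≡ e
  NSub-pow {q} (_ , inj₁ refl) = pow-e q
    where
    pow-e : ∀ k → pow B e k ≡ e
    pow-e zero = refl
    pow-e (suc k) = trans (identityˡ _) (pow-e k)
  NSub-pow (_ , inj₂ (_ , a^q≡e , _)) = a^q≡e

  [x·y⁻¹]·y : ∀ x y → x · inv y · y ≡ x
  [x·y⁻¹]·y x y = trans (assoc x _ y) (trans (cong (x ·_) (inverseˡ y)) (identityʳ x))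

  -- With `z = φ y` by surjectivity, `φ x · φ^ (π-1 x) z` is `φ (x · y)`, so the translating element
  -- is exactly the quotient that `LSub` puts into N.
  φ^π-1-translates : ∀ {q x} → LSub B φ q x → ∀ z → ∃ λ a → NSub B φ q a × φ^ (π-1 x) z ≡ a · z
  φ^π-1-translates {q} {x} x∈L z
    with y , φy≡z ← proj₂ bijective z
    with refl ← φy≡z {y} refl
    = a , x∈L y , ∙-cancelˡ (φ x) _ _ (begin
    φ x · φ^ (π-1 x) (φ y) ≡⟨ cong (φ x ·_) (iter-suc B φ (π-1 x) y) ⟩
    φ x · φ (φ^ (π-1 x) y) ≡⟨ φ-· x y ⟨
    φ (x · y)              ≡⟨ [x·y⁻¹]·y _ (φ x · φ y) ⟨
    a · (φ x · φ y)        ≡⟨ assoc a _ _ ⟨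
    a · φ x · φ y          ≡⟨ cong (_· φ y) (comm a (φ x)) ⟩
    φ x · a · φ y          ≡⟨ assoc _ a _ ⟩
    φ x · (a · φ y)        ∎)
    where
    a : Fin n
    a = φ (x · y) · inv (φ x · φ y)

  -- The translating element `a` lies in the kernel and is fixed by `φ^ (π-1 x)`, so `q`
  -- applications multiply `z` by the `q`-th power of `a`, which is `e`.
  φ^[q*π-1]≗id : ∀ {q x} → LSub B φ q x → ∀ z → φ^ (q * π-1 x) z ≡ z
  φ^[q*π-1]≗id {q} {x} x∈L z with a , a∈N , eq ← φ^π-1-translates x∈L z = begin
    φ^ (q * π-1 x) z           ≡⟨ iter-iter B φ (π-1 x) q z ⟨
    iter B (φ^ (π-1 x)) q z    ≡⟨ iter-translation commutes eq q ⟩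
    pow B a q · z              ≡⟨ cong (_· z) (NSub-pow a∈N) ⟩
    e · z                      ≡⟨ identityˡ z ⟩
    z                          ∎
    where
    a∈K = proj₁ a∈N
    commutes : ∀ w → φ^ (π-1 x) (a · w) ≡ a · φ^ (π-1 x) w
    commutes w = trans (φ^-Ker-· (π-1 x) a∈K w) (cong (_· _) (φ^π-1-fixes-Ker x a∈K))

  -- Cosets of the kernel inside L.

  Ker-·-admissible : ∀ {a} → Ker B φ a → ∀ x → φ^ (π-1 (a · x)) ≗ φ^ (π-1 x)
  Ker-·-admissible {a} a∈K x y = φ-injective (∙-cancelˡ (φ (a · x)) _ _ (begin
    φ (a · x) · φ (φ^ (π-1 (a · x)) y)  ≡⟨ φ-· (a · x) y ⟨
    φ (a · x · y)                       ≡⟨ cong φ (assoc a x y) ⟩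
    φ (a · (x · y))                     ≡⟨ a∈K _ ⟩
    φ a · φ (x · y)                     ≡⟨ cong (φ a ·_) (φ-· x y) ⟩
    φ a · (φ x · φ (φ^ (π-1 x) y))      ≡⟨ assoc _ _ _ ⟨
    φ a · φ x · φ (φ^ (π-1 x) y)        ≡⟨ cong (_· φ (φ^ (π-1 x) y)) (a∈K x) ⟨
    φ (a · x) · φ (φ^ (π-1 x) y)        ∎))

  -- The factor `φ a` splits off from `φ (a · x · y)` and from `φ (a · x) · φ y` and cancels, so the
  -- element tested for N is the same `d` as for `x`.
  Ker-·-LSub : ∀ {q a x} → Ker B φ a → LSub B φ q x → LSub B φ q (a · x)
  Ker-·-LSub {q} {a} {x} a∈K x∈L y = subst (NSub B φ q) (sym (∙-cancelʳ (φ (a · x) · φ y) _ _ (begin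
    φ (a · x · y) · inv (φ (a · x) · φ y) · (φ (a · x) · φ y) ≡⟨ [x·y⁻¹]·y _ _ ⟩
    φ (a · x · y)               ≡⟨ cong φ (assoc a x y) ⟩
    φ (a · (x · y))             ≡⟨ a∈K _ ⟩
    φ a · φ (x · y)             ≡⟨ cong (φ a ·_) ([x·y⁻¹]·y _ (φ x · φ y)) ⟨
    φ a · (d · (φ x · φ y))     ≡⟨ assoc _ d _ ⟨
    φ a · d · (φ x · φ y)       ≡⟨ cong (_· (φ x · φ y)) (comm (φ a) d) ⟩
    d · φ a · (φ x · φ y)       ≡⟨ assoc d _ _ ⟩
    d · (φ a · (φ x · φ y))     ≡⟨ cong (d ·_) (assoc _ _ _) ⟨
    d · (φ a · φ x · φ y)       ≡⟨ cong (λ w → d · (w · φ y)) (a∈K x) ⟨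
    d · (φ (a · x) · φ y)       ∎))) (x∈L y)
    where
    d : Fin n
    d = φ (x · y) · inv (φ x · φ y)

  -- Both φ ∘ (x ·_) and φ ∘ (x₀ ·_) equal φ^(π(x)) up to a translation, so
  -- φ conjugates translation by x x₀⁻¹ to a translation.
  φ^π-1-≗⇒Ker : ∀ {x x₀} → φ^ (π-1 x) ≗ φ^ (π-1 x₀) → Ker B φ (x · inv x₀)
  φ^π-1-≗⇒Ker {x} {x₀} eq b = begin
    φ (c · b)     ≡⟨ conjugate b ⟩
    d · φ b       ≡⟨ cong (_· φ b) φc≡d ⟨
    φ c · φ b     ∎
    where
    c d : Fin n
    c = x · inv x₀
    d = φ x · inv (φ x₀)

    conjugate′ : ∀ y → φ (x · y) ≡ d · φ (x₀ · y)
    conjugate′ y = begin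
      φ (x · y)                            ≡⟨ φ-· x y ⟩
      φ x · φ (φ^ (π-1 x) y)               ≡⟨ cong₂ _·_ (sym ([x·y⁻¹]·y (φ x) (φ x₀))) (cong φ (eq y)) ⟩
      d · φ x₀ · φ (φ^ (π-1 x₀) y)         ≡⟨ assoc d _ _ ⟩
      d · (φ x₀ · φ (φ^ (π-1 x₀) y))       ≡⟨ cong (d ·_) (φ-· x₀ y) ⟨
      d · φ (x₀ · y)                       ∎

    conjugate : ∀ b → φ (c · b) ≡ d · φ b
    conjugate b = begin
      φ (c · b)                    ≡⟨ cong φ (assoc x _ b) ⟩
      φ (x · (inv x₀ · b))         ≡⟨ conjugate′ _ ⟩
      d · φ (x₀ · (inv x₀ · b))    ≡⟨ cong (λ w → d · φ w) (assoc x₀ _ b) ⟨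
      d · φ (x₀ · inv x₀ · b)      ≡⟨ cong (λ w → d · φ (w · b)) (inverseʳ x₀) ⟩
      d · φ (e · b)                ≡⟨ cong (λ w → d · φ w) (identityˡ b) ⟩
      d · φ b                      ∎

    φc≡d : φ c ≡ d
    φc≡d = begin
      φ c       ≡⟨ cong φ (identityʳ c) ⟨
      φ (c · e) ≡⟨ conjugate e ⟩
      d · φ e   ≡⟨ cong (d ·_) fixes-e ⟩
      d · e     ≡⟨ identityʳ d ⟩
      d         ∎

  -- For x ∈ L the order of φ divides q (π(x)-1), and the residue of π(x)-1
  -- is determined by the quotient, which is less than q.
  class : ℕ → Fin n → ℕ
  class q x = q * (π-1 x % ord) / ord

  -- Counting L by classes.

  module _ {q : ℕ} .{{_ : NonZero q}} where

    class< : ∀ x → class q x < q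
    class< x = m<n*o⇒m/o<n (*-monoʳ-< q (m%n<n (π-1 x) ord))

    -- `ord` divides the numerator because the reduced exponent gives the same power of `φ` as
    -- `π-1 x`, and the `q`-th power of that is the identity; the division in `class` is therefore
    -- exact.
    class-*-ord : ∀ {x} → LSub B φ q x → class q x * ord ≡ q * (π-1 x % ord)
    class-*-ord {x} x∈L = m/n*n≡m (m%n≡0⇒n∣m _ ord (φ^≗id⇒%≡0 {q * (π-1 x % ord)} λ z → begin
      φ^ (q * (π-1 x % ord)) z        ≡⟨ iter-iter B φ (π-1 x % ord) q z ⟨
      iter B (φ^ (π-1 x % ord)) q z   ≡⟨ iter-cong q z ⟨
      iter B (φ^ (π-1 x)) q z         ≡⟨ iter-iter B φ (π-1 x) q z ⟩
      φ^ (q * π-1 x) z                ≡⟨ φ^[q*π-1]≗id x∈L z ⟩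
      z                               ∎))
      where
      iter-cong : ∀ k → iter B (φ^ (π-1 x)) k ≗ iter B (φ^ (π-1 x % ord)) k
      iter-cong zero z = refl
      iter-cong (suc k) z = trans (cong (φ^ (π-1 x)) (iter-cong k z)) (φ^-% (π-1 x) _)

    -- Exact division lets `class` recover `q * (π-1 x % ord)`, and cancelling `q` recovers the
    -- residue. Together with `class<` this is the bound by `q` on the solutions of `ψ^q = 1` that
    -- arise from L.
    class-≡⇒φ^-≗ : ∀ {x y} → LSub B φ q x → LSub B φ q y → class q x ≡ class q y →
                   φ^ (π-1 x) ≗ φ^ (π-1 y)
    class-≡⇒φ^-≗ {x} {y} x∈L y∈L eq = %≡⇒φ^-≗ {π-1 x} (*-cancelˡ-≡ _ _ q (begin
      q * (π-1 x % ord)  ≡⟨ class-*-ord x∈L ⟨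
      class q x * ord    ≡⟨ cong (_* ord) eq ⟩
      class q y * ord    ≡⟨ class-*-ord y∈L ⟩
      q * (π-1 y % ord)  ∎))

    class-Ker-· : ∀ {a} → Ker B φ a → ∀ x → class q (a · x) ≡ class q x
    class-Ker-· {a} a∈K x = cong (λ r → q * r / ord)
      (φ^-≗⇒%≡ {π-1 (a · x)} (Ker-·-admissible a∈K x))

    LSub-card : ∀ {kK kL} → HasCard B (Ker B φ) kK → HasCard B (LSub B φ q) kL →
                ∃ λ c → c ≤ q × kL ≡ c * kK
    LSub-card (ks , ks-unique , refl , ∈ks) (ls , ls-unique , refl , ∈ls) =
      length-multiple (class q) ls fibre (λ {x} _ → class< x)
      where
      open Equivalence

      fibre-list : ℕ → List (Fin n)
      fibre-list j = filter (λ x → class q x ≟ j) ls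

      -- The fibre through `x₀` is the coset of the kernel containing `x₀`; the two inclusions
      -- between duplicate-free lists give the two inequalities.
      coset : ∀ {j} x₀ → x₀ ∈ fibre-list j → length (fibre-list j) ≡ length ks
      coset {j} x₀ x₀∈ with ∈-filter⁻ (λ x → class q x ≟ j) {xs = ls} x₀∈
      ... | x₀∈ls , refl = trans
        (≤-antisym
          (unique-⊆⇒length≤ (Unique.filter⁺ _ ls-unique) λ {x} x∈ →
            let x∈ls , eq = ∈-filter⁻ (λ x → class q x ≟ j) {xs = ls} x∈
                x∈Kx₀ = φ^π-1-≗⇒Ker (class-≡⇒φ^-≗ (from (∈ls x) x∈ls) x₀∈L eq)
            in subst (_∈ map (_· x₀) ks) ([x·y⁻¹]·y x x₀)
                 (∈-map⁺ (_· x₀) (to (∈ks _) x∈Kx₀)))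
          (unique-⊆⇒length≤ (Unique.map⁺ (∙-cancelʳ x₀ _ _) ks-unique) λ x∈ → Kx₀⊆ (∈-map⁻ (_· x₀) x∈)))
        (length-map (_· x₀) ks)
        where
        x₀∈L = from (∈ls x₀) x₀∈ls
        Kx₀⊆ : ∀ {x} → ∃ (λ a → a ∈ ks × x ≡ a · x₀) → x ∈ fibre-list (class q x₀)
        Kx₀⊆ (a , a∈ks , refl) = ∈-filter⁺ (λ x → class q x ≟ class q x₀)
          (to (∈ls _) (Ker-·-LSub a∈K x₀∈L)) (class-Ker-· a∈K x₀)
          where a∈K = from (∈ks a) a∈ks

      fibre : ∀ j → length (fibre-list j) ≡ 0 ⊎ length (fibre-list j) ≡ length ks
      fibre j with fibre-list j | coset {j}
      ... | []     | _      = inj₁ refl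
      -- The head of a nonempty fibre serves as coset representative.
      ... | x ∷ _  | length≡ = inj₂ (length≡ x (here refl))

  Ker-e : Ker B φ e
  Ker-e b = begin
    φ (e · b)   ≡⟨ cong φ (identityˡ b) ⟩
    φ b         ≡⟨ identityˡ _ ⟨
    e · φ b     ≡⟨ cong (_· φ b) fixes-e ⟨
    φ e · φ b   ∎

  -- Makes L nonempty, which excludes `c = 0` in the final estimate.
  LSub-e : ∀ {q} → LSub B φ q e
  LSub-e {q} y = subst (NSub B φ q)
    (sym (trans (cong (_· inv (φ e · φ y)) (Ker-e y)) (inverseʳ _))) (Ker-e , inj₁ refl)

theorem3p2 : (B : FinAbGroup) → (φ : Fin (FinAbGroup.n B) → Fin (FinAbGroup.n B)) →
    IsSkewMorphism B φ →
    (p q kK kL : ℕ) →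
    HasCard B (Ker B φ) kK → HasCard B (LSub B φ q) kL →
    Prime q → q ∣ kK →
    Prime p → p ∣ kL → ¬ (p ∣ kK) →
    p < q
theorem3p2 B φ skew p q kK kL |K| |L|@(ls , _ , |ls|≡kL , ∈ls) q-prime q∣kK p-prime p∣kL p∤kK
  with LSub-card {{prime⇒nonZero q-prime}} |K| |L|
  where open SkewMorphism B φ skew
... | c , c≤q , refl with euclidsLemma c kK p-prime p∣kL
... | inj₂ p∣kK = contradiction p∣kK p∤kK
-- Divisibility bounds `p` by `c` once `c` is nonzero. Equality with `q` is excluded since `q`
-- divides `kK` and `p` does not.
... | inj₁ p∣c = ≤∧≢⇒< (≤-trans (∣⇒≤ {{c≢0}} p∣c) c≤q) λ { refl → p∤kK q∣kK }
  where
  open SkewMorphism B φ skew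
  c≢0 : NonZero c
  c≢0 = m*n≢0⇒m≢0 c {{>-nonZero (subst (0 <_) |ls|≡kL (∈-length (Equivalence.to (∈ls _) LSub-e)))}}
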